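{- For every integer $r\ge 4$ there is a constant $c_r>0$ such that every graph $G$ with $m=\chi(G)$ satisfies $$h_r(G)\ \ge\ c_r\min\left\{m,\ \min_{3\le \ell<r}\left(\frac{m^\ell}{C_\ell(G)+1}\right)^{1/(\ell-1)}\right\},$$ where $\ell$ ranges over integers.
   Context: All graphs are finite and simple; subgraphs need not be induced. The girth of a forest is $\infty$. $h_r(G)=\max\{\chi(H): H\subseteq G,\ \operatorname{girth}(H)\ge r\}$, where $\chi$ is the chromatic number (with $\chi(\emptyset)=0$). $C_\ell(G)$ is the number of cycles of length $\ell$ in $G$, counted as unoriented simple subgraphs. -}

module Defs where

open import Data.Bool.Properties using () renaming (_≟_ to _≟ᵇ_)
open import Data.Empty using (⊥-elim; ⊥-elim-irr)
open import Data.Fin as Fin using (Fin; toℕ; fromℕ<)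
import Data.Fin.Properties as Fin
open import Data.Fin.Subset as Subset using (Subset; inside; outside; _∈_; _∉_; _⊆_)
open import Data.Fin.Subset.Properties as Subset using (_∈?_; _⊆?_)
import Data.Integer as ℤ
open import Data.List as List using (List; []; _∷_)
open import Data.List.Membership.Propositional using () renaming (_∈_ to _∈ˡ_)
import Data.List.Membership.Propositional.Properties as List
open import Data.List.Relation.Unary.Any as Any using (here; there)
import Data.List.Relation.Unary.Any.Properties as Any
open import Data.List.Relation.Unary.Unique.Propositional using (Unique)
import Data.List.Relation.Unary.Unique.DecPropositional.Properties as Unique
open import Data.Maybe using (Maybe; just; nothing)
import Data.Maybe.Relation.Unary.Any as Maybe
open import Data.Nat as ℕ using (ℕ; zero; suc; z≤n; s≤s)
import Data.Nat.Properties as ℕ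
open import Data.Product using (∃; _×_; _,_; proj₁; proj₂)
open import Data.Rational as ℚ using (ℚ; 0ℚ; 1ℚ)
import Data.Rational.Properties as ℚ
open import Data.Rational.Solver using (module +-*-Solver)
open import Data.Sum using (_⊎_; inj₁; inj₂)
open import Data.Vec as Vec using (Vec; []; _∷_; lookup; tabulate)
import Data.Vec.Properties as Vec
open import Function using (_∘_; id; _⇔_; mk⇔; Equivalence)
open import Relation.Binary.Construct.Add.Supremum.NonStrict ℕ._≤_ using (_≤⁺_; [_]; _≤⊤⁺; ≤⁺-dec)
open import Relation.Binary.Definitions using (DecidableEquality)
open import Relation.Binary.PropositionalEquality
  using (_≡_; _≢_; refl; sym; trans; cong; subst)
open import Relation.Nullary using (¬_; Dec; yes; no; contradiction; ¬?; _×-dec_; _⊎-dec_; _→-dec_; recompute)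
open import Relation.Nullary.Decidable using (map′)
open import Relation.Nullary.Construct.Add.Supremum using (_⁺; ⊤⁺; [_])
open import Relation.Unary using (Decidable)
open import Algebra.Definitions.RawSemiring ℚ.+-*-rawSemiring using () renaming (_^_ to _^ℚ_)

-- A Dedekind cut: x is represented by the set of rationals L = { q | q < x }.
record ℝ : Set₁ where
  field
    L         : ℚ → Set
    inhabited : ∃ L
    bounded   : ∃ λ u → ∀ {q} → L q → q ℚ.< u
    downward  : ∀ {p q} → p ℚ.≤ q → L q → L p
    rounded   : ∀ {q} → L q → ∃ λ p → q ℚ.< p × L p

open ℝ public

infix 4 _≤ℝ_ _<ℝ_

_≤ℝ_ : ℝ → ℝ → Set
x ≤ℝ y = ∀ {q} → L x q → L y q

_<ℝ_ : ℝ → ℝ → Set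
x <ℝ y = ∃ λ q → ¬ L x q × L y q

p-1<p : ∀ p → p ℚ.- 1ℚ ℚ.< p
p-1<p p = subst (p ℚ.- 1ℚ ℚ.<_) (ℚ.+-identityʳ p) (ℚ.+-monoʳ-< p (ℚ.*<* ℤ.-<+))

fromℚ : ℚ → ℝ
fromℚ a = record
  { L         = ℚ._< a
  ; inhabited = a ℚ.- 1ℚ , p-1<p a
  ; bounded   = a , id
  ; downward  = ℚ.≤-<-trans
  ; rounded   = ℚ.<-dense
  }

fromℕ : ℕ → ℝ
fromℕ n = fromℚ (ℤ.+ n ℚ./ 1)

0ℝ : ℝ
0ℝ = fromℚ 0ℚ

infixl 6 _⊓ℝ_

_⊓ℝ_ : ℝ → ℝ → ℝ
x ⊓ℝ y = record
  { L         = λ q → L x q × L y q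
  ; inhabited = let (p , p∈x) = inhabited x ; (q , q∈y) = inhabited y in
                p ℚ.⊓ q , downward x (ℚ.p⊓q≤p p q) p∈x , downward y (ℚ.p⊓q≤q p q) q∈y
  ; bounded   = proj₁ (bounded x) , proj₂ (bounded x) ∘ proj₁
  ; downward  = λ p≤q (q∈x , q∈y) → downward x p≤q q∈x , downward y p≤q q∈y
  ; rounded   = λ (q∈x , q∈y) →
                let (p₁ , q<p₁ , p₁∈x) = rounded x q∈x
                    (p₂ , q<p₂ , p₂∈y) = rounded y q∈y
                in p₁ ℚ.⊓ p₂ , <-⊓ q<p₁ q<p₂
                 , downward x (ℚ.p⊓q≤p p₁ p₂) p₁∈x , downward y (ℚ.p⊓q≤q p₁ p₂) p₂∈y
  }
  where
  <-⊓ : ∀ {q p₁ p₂} → q ℚ.< p₁ → q ℚ.< p₂ → q ℚ.< p₁ ℚ.⊓ p₂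
  <-⊓ {q} {p₁} {p₂} a b with ℚ.⊓-sel p₁ p₂
  ... | inj₁ e = subst (q ℚ.<_) (sym e) a
  ... | inj₂ e = subst (q ℚ.<_) (sym e) b

minimum : ℝ → List ℝ → ℝ
minimum = List.foldr _⊓ℝ_

*-mono-≤ : ∀ {a b c d} → 0ℚ ℚ.≤ a → 0ℚ ℚ.≤ d → a ℚ.≤ b → c ℚ.≤ d → a ℚ.* c ℚ.≤ b ℚ.* d
*-mono-≤ {a} {b} {c} {d} 0≤a 0≤d a≤b c≤d = ℚ.≤-trans
  (ℚ.*-monoˡ-≤-nonNeg a {{ℚ.nonNegative 0≤a}} c≤d)
  (ℚ.*-monoʳ-≤-nonNeg d {{ℚ.nonNegative 0≤d}} a≤b)

*-mono-< : ∀ {a b c d} → 0ℚ ℚ.≤ a → 0ℚ ℚ.≤ c → a ℚ.< b → c ℚ.< d → a ℚ.* c ℚ.< b ℚ.* d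
*-mono-< {a} {b} {c} {d} 0≤a 0≤c a<b c<d = ℚ.≤-<-trans
  (ℚ.*-monoˡ-≤-nonNeg a {{ℚ.nonNegative 0≤a}} (ℚ.<⇒≤ c<d))
  (ℚ.*-monoˡ-<-pos d {{ℚ.positive (ℚ.≤-<-trans 0≤c c<d)}} a<b)

0≤1 : 0ℚ ℚ.≤ 1ℚ
0≤1 = ℚ.*≤* (ℤ.+≤+ z≤n)

0<1 : 0ℚ ℚ.< 1ℚ
0<1 = ℚ.*<* (ℤ.+<+ (s≤s z≤n))

infixl 7 _*ℝ_

-- The product of nonnegative reals only; no meaning is attached to it when a
-- factor is negative.
_*ℝ_ : ℝ → ℝ → ℝ
x *ℝ y = record
  { L         = M
  ; inhabited = 0ℚ ℚ.- 1ℚ , inj₁ (p-1<p 0ℚ)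
  ; bounded   = U ℚ.* V , λ
    { (inj₁ q<0) → ℚ.<-trans q<0 (*-mono-< ℚ.≤-refl ℚ.≤-refl 0<U 0<V)
    ; (inj₂ (a , b , 0≤a , 0≤b , a∈x , b∈y , q≤ab)) → ℚ.≤-<-trans q≤ab
        (*-mono-< 0≤a 0≤b (ℚ.<-≤-trans (proj₂ (bounded x) a∈x) (ℚ.p≤p⊔q u 1ℚ))
                          (ℚ.<-≤-trans (proj₂ (bounded y) b∈y) (ℚ.p≤p⊔q v 1ℚ))) }
  ; downward  = λ
    { p≤q (inj₁ q<0) → inj₁ (ℚ.≤-<-trans p≤q q<0)
    ; p≤q (inj₂ (a , b , 0≤a , 0≤b , a∈x , b∈y , q≤ab)) →
        inj₂ (a , b , 0≤a , 0≤b , a∈x , b∈y , ℚ.≤-trans p≤q q≤ab) }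
  ; rounded   = λ
    { (inj₁ q<0) → let (m , q<m , m<0) = ℚ.<-dense q<0 in m , q<m , inj₁ m<0
    ; (inj₂ (a , b , 0≤a , 0≤b , a∈x , b∈y , q≤ab)) →
        let (a′ , a<a′ , a′∈x) = rounded x a∈x
            (b′ , b<b′ , b′∈y) = rounded y b∈y
        in a′ ℚ.* b′ , ℚ.≤-<-trans q≤ab (*-mono-< 0≤a 0≤b a<a′ b<b′)
         , inj₂ (a′ , b′ , ℚ.≤-trans 0≤a (ℚ.<⇒≤ a<a′) , ℚ.≤-trans 0≤b (ℚ.<⇒≤ b<b′)
                , a′∈x , b′∈y , ℚ.≤-refl) }
  }
  where
  M : ℚ → Set
  M q = q ℚ.< 0ℚ ⊎ ∃ λ a → ∃ λ b →
        0ℚ ℚ.≤ a × 0ℚ ℚ.≤ b × L x a × L y b × q ℚ.≤ a ℚ.* b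
  u = proj₁ (bounded x)
  v = proj₁ (bounded y)
  U = u ℚ.⊔ 1ℚ
  V = v ℚ.⊔ 1ℚ
  0<U : 0ℚ ℚ.< U
  0<U = ℚ.<-≤-trans 0<1 (ℚ.p≤q⊔p u 1ℚ)
  0<V : 0ℚ ℚ.< V
  0<V = ℚ.<-≤-trans 0<1 (ℚ.p≤q⊔p v 1ℚ)

*-continuous : ∀ {a b y} → 0ℚ ℚ.≤ a → 0ℚ ℚ.≤ b → a ℚ.* b ℚ.< y →
               ∃ λ a′ → ∃ λ b′ → a ℚ.< a′ × b ℚ.< b′ × a′ ℚ.* b′ ℚ.< y
*-continuous {a} {b} {y} 0≤a 0≤b ab<y =
  a ℚ.+ ε , b ℚ.+ ε , grow a , grow b , (begin-strict
    (a ℚ.+ ε) ℚ.* (b ℚ.+ ε)         ≡⟨ expand a b ε ⟩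
    a ℚ.* b ℚ.+ ε ℚ.* (a ℚ.+ b ℚ.+ ε)
      ≤⟨ ℚ.+-monoʳ-≤ (a ℚ.* b) (ℚ.*-monoˡ-≤-nonNeg ε {{ℚ.nonNegative (ℚ.<⇒≤ 0<ε)}}
           (ℚ.+-monoʳ-≤ (a ℚ.+ b) (ℚ.<⇒≤ (ℚ.<-≤-trans ε<t⊓1 (ℚ.p⊓q≤q t 1ℚ))))) ⟩
    a ℚ.* b ℚ.+ ε ℚ.* s
      <⟨ ℚ.+-monoʳ-< (a ℚ.* b) (ℚ.*-monoˡ-<-pos s (ℚ.<-≤-trans ε<t⊓1 (ℚ.p⊓q≤p t 1ℚ))) ⟩
    a ℚ.* b ℚ.+ d ℚ.* (ℚ.1/ s) ℚ.* s  ≡⟨ cong (a ℚ.* b ℚ.+_) (ℚ.*-assoc d (ℚ.1/ s) s) ⟩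
    a ℚ.* b ℚ.+ d ℚ.* ((ℚ.1/ s) ℚ.* s) ≡⟨ cong (λ z → a ℚ.* b ℚ.+ d ℚ.* z) (ℚ.*-inverseˡ s) ⟩
    a ℚ.* b ℚ.+ d ℚ.* 1ℚ              ≡⟨ cong (a ℚ.* b ℚ.+_) (ℚ.*-identityʳ d) ⟩
    a ℚ.* b ℚ.+ (y ℚ.- a ℚ.* b)       ≡⟨ cancel (a ℚ.* b) y ⟩
    y ∎)
  where
  open ℚ.≤-Reasoning
  s = a ℚ.+ b ℚ.+ 1ℚ
  instance
    s-pos : ℚ.Positive s
    s-pos = ℚ.positive (ℚ.+-mono-≤-< (ℚ.+-mono-≤ 0≤a 0≤b) 0<1)
    s-nonZero : ℚ.NonZero s
    s-nonZero = ℚ.pos⇒nonZero s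
  d = y ℚ.- a ℚ.* b
  t = d ℚ.* (ℚ.1/ s)
  cancel : ∀ p q → p ℚ.+ (q ℚ.- p) ≡ q
  cancel = +-*-Solver.solve 2 (λ p q → p :+ (q :- p) := q) refl
    where open +-*-Solver
  expand : ∀ p q e → (p ℚ.+ e) ℚ.* (q ℚ.+ e) ≡ p ℚ.* q ℚ.+ e ℚ.* (p ℚ.+ q ℚ.+ e)
  expand = +-*-Solver.solve 3 (λ p q e → (p :+ e) :* (q :+ e) := p :* q :+ e :* (p :+ q :+ e)) refl
    where open +-*-Solver
  0<d : 0ℚ ℚ.< d
  0<d = subst (ℚ._< d) (ℚ.+-inverseʳ (a ℚ.* b)) (ℚ.+-monoˡ-< (ℚ.- (a ℚ.* b)) ab<y)
  0<t : 0ℚ ℚ.< t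
  0<t = subst (ℚ._< t) (ℚ.*-zeroˡ (ℚ.1/ s)) (ℚ.*-monoˡ-<-pos (ℚ.1/ s) {{ℚ.1/pos⇒pos s}} 0<d)
  0<t⊓1 : 0ℚ ℚ.< t ℚ.⊓ 1ℚ
  0<t⊓1 with ℚ.⊓-sel t 1ℚ
  ... | inj₁ e = subst (0ℚ ℚ.<_) (sym e) 0<t
  ... | inj₂ e = subst (0ℚ ℚ.<_) (sym e) 0<1
  ε = proj₁ (ℚ.<-dense 0<t⊓1)
  0<ε : 0ℚ ℚ.< ε
  0<ε = proj₁ (proj₂ (ℚ.<-dense 0<t⊓1))
  ε<t⊓1 : ε ℚ.< t ℚ.⊓ 1ℚ
  ε<t⊓1 = proj₂ (proj₂ (ℚ.<-dense 0<t⊓1))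
  grow : ∀ p → p ℚ.< p ℚ.+ ε
  grow p = subst (ℚ._< p ℚ.+ ε) (ℚ.+-identityʳ p) (ℚ.+-monoʳ-< p 0<ε)

0≤^ : ∀ {q} k → 0ℚ ℚ.≤ q → 0ℚ ℚ.≤ q ^ℚ k
0≤^ zero    0≤q = 0≤1
0≤^ (suc k) 0≤q = *-mono-≤ ℚ.≤-refl (0≤^ k 0≤q) 0≤q (0≤^ k 0≤q)

^-mono-≤ : ∀ {p q} k → 0ℚ ℚ.≤ p → p ℚ.≤ q → p ^ℚ k ℚ.≤ q ^ℚ k
^-mono-≤ zero    0≤p p≤q = ℚ.≤-refl
^-mono-≤ (suc k) 0≤p p≤q = *-mono-≤ 0≤p (0≤^ k (ℚ.≤-trans 0≤p p≤q)) p≤q (^-mono-≤ k 0≤p p≤q)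

1≤^ : ∀ {q} k → 1ℚ ℚ.≤ q → 1ℚ ℚ.≤ q ^ℚ k
1≤^ zero    1≤q = ℚ.≤-refl
1≤^ (suc k) 1≤q = *-mono-≤ 0≤1 (ℚ.≤-trans 0≤1 (1≤^ k 1≤q)) 1≤q (1≤^ k 1≤q)

^-continuous : ∀ {q y} k → 0ℚ ℚ.≤ q → q ^ℚ k ℚ.< y → ∃ λ p → q ℚ.< p × p ^ℚ k ℚ.< y
^-continuous {q} zero 0≤q 1<y =
  q ℚ.+ 1ℚ , subst (ℚ._< q ℚ.+ 1ℚ) (ℚ.+-identityʳ q) (ℚ.+-monoʳ-< q 0<1) , 1<y
^-continuous {q} (suc k) 0≤q lt =
  let (a , b , q<a , qᵏ<b , ab<y) = *-continuous 0≤q (0≤^ k 0≤q) lt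
      (p , q<p , pᵏ<b)            = ^-continuous k 0≤q qᵏ<b
      (m , q<m , m≤a , m≤p)       = between q<a q<p
      0≤m                         = ℚ.≤-trans 0≤q (ℚ.<⇒≤ q<m)
  in m , q<m , ℚ.≤-<-trans
       (*-mono-≤ 0≤m (ℚ.≤-trans (0≤^ k 0≤q) (ℚ.<⇒≤ qᵏ<b)) m≤a
         (ℚ.≤-trans (^-mono-≤ k 0≤m m≤p) (ℚ.<⇒≤ pᵏ<b)))
       ab<y
  where
  between : ∀ {q a p} → q ℚ.< a → q ℚ.< p → ∃ λ m → q ℚ.< m × m ℚ.≤ a × m ℚ.≤ p
  between {q} {a} {p} q<a q<p with ℚ.≤-total a p
  ... | inj₁ a≤p = a , q<a , ℚ.≤-refl , a≤p
  ... | inj₂ p≤a = p , q<p , p≤a , ℚ.≤-refl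

-- x^(1/k) for x ≥ 0: a rational q satisfies q < x^(1/k) iff q < 0 or q^k < x.
root : (k : ℕ) → .{{ℕ.NonZero k}} → ℝ → ℝ
root k@(suc j) x = record
  { L         = λ q → q ℚ.< 0ℚ ⊎ L x (q ^ℚ k)
  ; inhabited = 0ℚ ℚ.- 1ℚ , inj₁ (p-1<p 0ℚ)
  ; bounded   = U , bound
  ; downward  = down
  ; rounded   = round
  }
  where
  u = proj₁ (bounded x)
  U = u ℚ.⊔ 1ℚ
  1≤U : 1ℚ ℚ.≤ U
  1≤U = ℚ.p≤q⊔p u 1ℚ
  bound : ∀ {q} → q ℚ.< 0ℚ ⊎ L x (q ^ℚ k) → q ℚ.< U
  bound (inj₁ q<0) = ℚ.<-trans q<0 (ℚ.<-≤-trans 0<1 1≤U)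
  bound {q} (inj₂ qᵏ∈x) with q ℚ.<? U
  ... | yes q<U = q<U
  ... | no  q≮U = ⊥-elim (ℚ.<-irrefl refl (ℚ.<-≤-trans (proj₂ (bounded x) qᵏ∈x) u≤qᵏ))
    where
    U≤q : U ℚ.≤ q
    U≤q = ℚ.≮⇒≥ q≮U
    1≤q : 1ℚ ℚ.≤ q
    1≤q = ℚ.≤-trans 1≤U U≤q
    q≤qᵏ : q ℚ.≤ q ^ℚ k
    q≤qᵏ = subst (ℚ._≤ q ^ℚ k) (ℚ.*-identityʳ q)
      (*-mono-≤ (ℚ.≤-trans 0≤1 1≤q) (ℚ.≤-trans 0≤1 (1≤^ j 1≤q)) ℚ.≤-refl (1≤^ j 1≤q))
    u≤qᵏ : u ℚ.≤ q ^ℚ k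
    u≤qᵏ = ℚ.≤-trans (ℚ.p≤p⊔q u 1ℚ) (ℚ.≤-trans U≤q q≤qᵏ)
  down : ∀ {p q} → p ℚ.≤ q → q ℚ.< 0ℚ ⊎ L x (q ^ℚ k) → p ℚ.< 0ℚ ⊎ L x (p ^ℚ k)
  down p≤q (inj₁ q<0) = inj₁ (ℚ.≤-<-trans p≤q q<0)
  down {p} p≤q (inj₂ qᵏ∈x) with p ℚ.<? 0ℚ
  ... | yes p<0 = inj₁ p<0
  ... | no  p≮0 = inj₂ (downward x (^-mono-≤ k (ℚ.≮⇒≥ p≮0) p≤q) qᵏ∈x)
  round : ∀ {q} → q ℚ.< 0ℚ ⊎ L x (q ^ℚ k) → ∃ λ p → q ℚ.< p × (p ℚ.< 0ℚ ⊎ L x (p ^ℚ k))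
  negative : ∀ {q} → q ℚ.< 0ℚ → ∃ λ p → q ℚ.< p × (p ℚ.< 0ℚ ⊎ L x (p ^ℚ k))
  negative q<0 = let (m , q<m , m<0) = ℚ.<-dense q<0 in m , q<m , inj₁ m<0
  round (inj₁ q<0) = negative q<0
  round {q} (inj₂ qᵏ∈x) with q ℚ.<? 0ℚ
  ... | yes q<0 = negative q<0
  ... | no  q≮0 =
    let (y , qᵏ<y , y∈x) = rounded x qᵏ∈x
        (p , q<p , pᵏ<y) = ^-continuous k (ℚ.≮⇒≥ q≮0) qᵏ<y
    in p , q<p , inj₂ (downward x (ℚ.<⇒≤ pᵏ<y) y∈x)

least : {P : ℕ → Set} → Decidable P → ∀ b → P b → ∃ λ k → P k × (∀ j → P j → k ℕ.≤ j)
least P? zero    p = 0 , p , λ _ _ → z≤n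
least P? (suc b) p with P? 0
... | yes p₀ = 0 , p₀ , λ _ _ → z≤n
... | no ¬p₀ with least (P? ∘ suc) b p
...   | k , pₖ , min = suc k , pₖ , λ { zero p₀ → contradiction p₀ ¬p₀ ; (suc j) pⱼ → s≤s (min j pⱼ) }

greatest : {P : ℕ → Set} → Decidable P → ∀ b → (∀ j → P j → j ℕ.≤ b) → ∃ P →
           ∃ λ k → P k × (∀ j → P j → j ℕ.≤ k)
greatest P? b bnd (a , p) with P? b
... | yes pᵦ = b , pᵦ , bnd
greatest {P} P? zero bnd (a , p) | no ¬pᵦ =
  contradiction (subst P (ℕ.n≤0⇒n≡0 (bnd a p)) p) ¬pᵦ
greatest P? (suc b) bnd w | no ¬pᵦ =
  greatest P? b (λ j pⱼ → ℕ.s≤s⁻¹ (ℕ.≤∧≢⇒< (bnd j pⱼ) (λ { refl → ¬pᵦ pⱼ }))) w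

∃-dec : {A : Set} {P : A → Set} (xs : List A) → (∀ x → x ∈ˡ xs) → Decidable P → Dec (∃ P)
∃-dec xs complete P? = map′ Any.satisfied (λ (x , p) → Any.map (λ { refl → p }) (complete x)) (Any.any? P? xs)

allVecs : {A : Set} → List A → ∀ n → List (Vec A n)
allVecs xs zero    = [] ∷ []
allVecs xs (suc n) = List.cartesianProductWith _∷_ xs (allVecs xs n)

allVecs-complete : {A : Set} {xs : List A} → (∀ x → x ∈ˡ xs) → ∀ {n} (v : Vec A n) → v ∈ˡ allVecs xs n
allVecs-complete c []      = here refl
allVecs-complete c (x ∷ v) = List.∈-cartesianProductWith⁺ _∷_ (c x) (allVecs-complete c v)

allSubsets : ∀ n → List (Subset n)
allSubsets = allVecs (inside ∷ outside ∷ [])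

allSubsets-complete : ∀ {n} (S : Subset n) → S ∈ˡ allSubsets n
allSubsets-complete = allVecs-complete λ { inside → here refl ; outside → there (here refl) }

_⇔-dec_ : {A B : Set} → Dec A → Dec B → Dec (A ⇔ B)
a? ⇔-dec b? = map′ (λ (f , g) → mk⇔ f g) (λ e → Equivalence.to e , Equivalence.from e)
                   ((a? →-dec b?) ×-dec (b? →-dec a?))

record IsSimple {n} (V : Subset n) (N : Vec (Subset n) n) : Set where
  constructor isSimple
  field
    symmetric   : ∀ x y → y ∈ lookup N x → x ∈ lookup N y
    irreflexive : ∀ x → x ∉ lookup N x
    incident    : ∀ x y → y ∈ lookup N x → x ∈ V

-- A finite simple graph whose vertex set V is a subset of Fin n; lookup N x is
-- the set of neighbours of x.  Since V may be a proper subset of Fin n, a graph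
-- and its (not necessarily induced or spanning) subgraphs are of the same type.
-- The proof of simplicity is irrelevant, so that _≡_ is equality of vertex sets
-- and edge sets, as needed for counting subgraphs.
record Graph (n : ℕ) : Set where
  constructor mkGraph
  field
    V       : Subset n
    N       : Vec (Subset n) n
    .simple : IsSimple V N

open Graph public using (V; N)

Adj : ∀ {n} → Graph n → Fin n → Fin n → Set
Adj G x y = y ∈ lookup (N G) x

infix 4 _⊆ᴳ_

_⊆ᴳ_ : ∀ {n} → Graph n → Graph n → Set
H ⊆ᴳ G = V H ⊆ V G × (∀ x → lookup (N H) x ⊆ lookup (N G) x)

isSimple? : ∀ {n} (V : Subset n) N → Dec (IsSimple V N)
isSimple? V N = map′ (λ (s , i , v) → isSimple s i v) (λ (isSimple s i v) → s , i , v)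
  (Fin.all? (λ x → Fin.all? λ y → (y ∈? lookup N x) →-dec (x ∈? lookup N y))
   ×-dec Fin.all? (λ x → ¬? (x ∈? lookup N x))
   ×-dec Fin.all? (λ x → Fin.all? λ y → (y ∈? lookup N x) →-dec (x ∈? V)))

simple : ∀ {n} (G : Graph n) → IsSimple (V G) (N G)
simple (mkGraph V N s) = recompute (isSimple? V N) s

_⊆ᴳ?_ : ∀ {n} (H G : Graph n) → Dec (H ⊆ᴳ G)
H ⊆ᴳ? G = (V H ⊆? V G) ×-dec Fin.all? (λ x → lookup (N H) x ⊆? lookup (N G) x)

_≟ᴳ_ : ∀ {n} → DecidableEquality (Graph n)
mkGraph V N _ ≟ᴳ mkGraph V′ N′ _ =
  map′ (λ { (refl , refl) → refl }) (λ { refl → refl , refl })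
       (Vec.≡-dec _≟ᵇ_ V V′ ×-dec Vec.≡-dec (Vec.≡-dec _≟ᵇ_) N N′)

toGraph : ∀ {n} → Subset n × Vec (Subset n) n → Maybe (Graph n)
toGraph (V , N) with isSimple? V N
... | yes s = just (mkGraph V N s)
... | no  _ = nothing

toGraph-complete : ∀ {n} (G : Graph n) → toGraph (V G , N G) ≡ just G
toGraph-complete (mkGraph V N s) with isSimple? V N
... | yes _ = refl
... | no ¬s = ⊥-elim-irr (¬s s)

allGraphs : ∀ n → List (Graph n)
allGraphs n = List.mapMaybe toGraph (List.cartesianProduct (allSubsets n) (allVecs (allSubsets n) n))

allGraphs-complete : ∀ {n} (G : Graph n) → G ∈ˡ allGraphs n
allGraphs-complete {n} G = Any.mapMaybe⁺ toGraph _ (Any.map⁺ (Any.map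
  (λ { refl → subst (Maybe.Any (G ≡_)) (sym (toGraph-complete G)) (Maybe.just refl) })
  (List.∈-cartesianProduct⁺ (allSubsets-complete (V G))
                            (allVecs-complete allSubsets-complete (N G)))))

-- Values of a colouring outside the vertex set are unconstrained, so the graph
-- without vertices is 0-colourable.
Colourable : ∀ {n} → ℕ → Graph n → Set
Colourable {n} k G = ∃ λ (c : Fin n → ℕ) →
  (∀ x → x ∈ V G → c x ℕ.< k) × (∀ x y → Adj G x y → c x ≢ c y)

IsChromaticNumber : ∀ {n} → Graph n → ℕ → Set
IsChromaticNumber G k = Colourable k G × (∀ j → Colourable j G → k ℕ.≤ j)

colourable? : ∀ {n} k (G : Graph n) → Dec (Colourable k G)
colourable? {n} k G = map′
  (λ (v , p , q) → toℕ ∘ lookup v , p , q) to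
  (∃-dec (allVecs (List.allFin (suc k)) n) (allVecs-complete List.∈-allFin) λ v →
    Fin.all? (λ x → (x ∈? V G) →-dec (toℕ (lookup v x) ℕ.<? k)) ×-dec
    Fin.all? (λ x → Fin.all? λ y → (y ∈? lookup (N G) x) →-dec
      ¬? (toℕ (lookup v x) ℕ.≟ toℕ (lookup v y))))
  where
  to : Colourable k G → ∃ λ (v : Vec (Fin (suc k)) n) →
       (∀ x → x ∈ V G → toℕ (lookup v x) ℕ.< k) ×
       (∀ x y → Adj G x y → toℕ (lookup v x) ≢ toℕ (lookup v y))
  to (c , p , q) = v , (λ x x∈V → subst (ℕ._< k) (sym (same x x∈V)) (p x x∈V))
                     , λ x y xy e → q x y xy (trans (sym (same x (incident x y xy)))
                         (trans e (same y (incident y x (symmetric x y xy)))))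
    where
    open IsSimple (simple G)
    v : Vec (Fin (suc k)) n
    v = tabulate λ x → fromℕ< (s≤s (ℕ.m⊓n≤n (c x) k))
    same : ∀ x → x ∈ V G → toℕ (lookup v x) ≡ c x
    same x x∈V = trans (cong toℕ (Vec.lookup∘tabulate _ x))
      (trans (Fin.toℕ-fromℕ< _) (ℕ.m≤n⇒m⊓n≡m (ℕ.<⇒≤ (p x x∈V))))

n-colourable : ∀ {n} (G : Graph n) → Colourable n G
n-colourable G = toℕ , (λ x _ → Fin.toℕ<n x) ,
  λ x y xy e → IsSimple.irreflexive (simple G) x (subst (Adj G x) (sym (Fin.toℕ-injective e)) xy)

-- Abstract, as a number is determined by its specification and the exhaustive
-- search that finds it should not be unfolded; likewise below.
abstract
  chromaticNumber : ∀ {n} (G : Graph n) → ∃ (IsChromaticNumber G)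
  chromaticNumber {n} G = least (λ k → colourable? k G) n (n-colourable G)

χ : ∀ {n} → Graph n → ℕ
χ = proj₁ ∘ chromaticNumber

Consecutive : ∀ {ℓ} → Fin ℓ → Fin ℓ → Set
Consecutive {ℓ} i j = suc (toℕ i) ≡ toℕ j ⊎ (suc (toℕ i) ≡ ℓ × toℕ j ≡ 0)

-- The graph G is (as a whole) a cycle of length ℓ, with v listing its vertices
-- in cyclic order.
record IsCycle {n} (ℓ : ℕ) (G : Graph n) : Set where
  constructor isCycle
  field
    3≤ℓ       : 3 ℕ.≤ ℓ
    v         : Vec (Fin n) ℓ
    injective : ∀ i j → lookup v i ≡ lookup v j → i ≡ j
    vertices  : ∀ x → x ∈ V G ⇔ ∃ λ i → lookup v i ≡ x
    edges     : ∀ i j → Adj G (lookup v i) (lookup v j) ⇔ (Consecutive i j ⊎ Consecutive j i)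

isCycle? : ∀ {n} ℓ (G : Graph n) → Dec (IsCycle ℓ G)
isCycle? {n} ℓ G = map′
  (λ (b , v , i , p , q) → isCycle b v i p q) (λ (isCycle b v i p q) → b , v , i , p , q)
  ((3 ℕ.≤? ℓ) ×-dec ∃-dec (allVecs (List.allFin n) ℓ) (allVecs-complete List.∈-allFin) λ v →
    Fin.all? (λ i → Fin.all? λ j → (lookup v i Fin.≟ lookup v j) →-dec (i Fin.≟ j)) ×-dec
    Fin.all? (λ x → (x ∈? V G) ⇔-dec Fin.any? λ i → lookup v i Fin.≟ x) ×-dec
    Fin.all? (λ i → Fin.all? λ j →
      (lookup v j ∈? lookup (N G) (lookup v i)) ⇔-dec (consecutive? i j ⊎-dec consecutive? j i)))
  where
  consecutive? : ∀ (i j : Fin ℓ) → Dec (Consecutive i j)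
  consecutive? i j = (suc (toℕ i) ℕ.≟ toℕ j) ⊎-dec ((suc (toℕ i) ℕ.≟ ℓ) ×-dec (toℕ j ℕ.≟ 0))

_IsCycleOfLength_In_ : ∀ {n} → Graph n → ℕ → Graph n → Set
Z IsCycleOfLength ℓ In G = Z ⊆ᴳ G × IsCycle ℓ Z

abstract
  cycles : ∀ {n} ℓ (G : Graph n) →
           ∃ λ Zs → Unique Zs × (∀ Z → Z ∈ˡ Zs ⇔ Z IsCycleOfLength ℓ In G)
  cycles {n} ℓ G = Zs , Unique.deduplicate-! _≟ᴳ_ found , λ Z → mk⇔
    (λ Z∈ → proj₂ (List.∈-filter⁻ cycle? {xs = allGraphs n} (List.∈-deduplicate⁻ _≟ᴳ_ found Z∈)))
    (λ cyc → List.∈-deduplicate⁺ _≟ᴳ_ (List.∈-filter⁺ cycle? (allGraphs-complete Z) cyc))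
    where
    cycle? : Decidable (λ Z → Z IsCycleOfLength ℓ In G)
    cycle? Z = (Z ⊆ᴳ? G) ×-dec isCycle? ℓ Z
    found Zs : List (Graph n)
    found = List.filter cycle? (allGraphs n)
    Zs = List.deduplicate _≟ᴳ_ found

C : ∀ {n} → ℕ → Graph n → ℕ
C ℓ G = List.length (proj₁ (cycles ℓ G))

HasCycle : ∀ {n} → Graph n → ℕ → Set
HasCycle G ℓ = ∃ λ Z → Z IsCycleOfLength ℓ In G

hasCycle? : ∀ {n} (G : Graph n) ℓ → Dec (HasCycle G ℓ)
hasCycle? {n} G ℓ = ∃-dec (allGraphs n) allGraphs-complete λ Z → (Z ⊆ᴳ? G) ×-dec isCycle? ℓ Z

cycle-length≤n : ∀ {n} {G : Graph n} ℓ → HasCycle G ℓ → ℓ ℕ.≤ n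
cycle-length≤n ℓ (_ , _ , cyc) = Fin.injective⇒≤ {f = lookup v} (λ {i} {j} → injective i j)
  where open IsCycle cyc

-- ⊤⁺ is the value ∞, attained by forests.
IsGirth : ∀ {n} → Graph n → ℕ ⁺ → Set
IsGirth G [ g ] = HasCycle G g × (∀ ℓ → HasCycle G ℓ → g ℕ.≤ ℓ)
IsGirth G ⊤⁺    = ∀ ℓ → ¬ HasCycle G ℓ

abstract
  ∃-girth : ∀ {n} (G : Graph n) → ∃ (IsGirth G)
  ∃-girth {n} G with ℕ.anyUpTo? (hasCycle? G) (suc n)
  ... | yes (b , _ , cyc) = let (g , p) = least (hasCycle? G) b cyc in [ g ] , p
  ... | no ¬cyc = ⊤⁺ , λ ℓ cyc → ¬cyc (ℓ , s≤s (cycle-length≤n {G = G} ℓ cyc) , cyc)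

girth : ∀ {n} → Graph n → ℕ ⁺
girth = proj₁ ∘ ∃-girth

IsMaxChromatic : ∀ {n} → ℕ → Graph n → ℕ → Set
IsMaxChromatic r G k =
  (∃ λ H → H ⊆ᴳ G × [ r ] ≤⁺ girth H × χ H ≡ k) ×
  (∀ H → H ⊆ᴳ G → [ r ] ≤⁺ girth H → χ H ℕ.≤ k)

∅ᴳ : ∀ {n} → Graph n
∅ᴳ {n} = mkGraph Subset.⊥ (Vec.replicate n Subset.⊥)
  (isSimple (λ x y → ⊥-elim ∘ none x y) (λ x → none x x) (λ x y → ⊥-elim ∘ none x y))
  where
  none : ∀ x y → y ∉ lookup (Vec.replicate n Subset.⊥) x
  none x y = Subset.∉⊥ ∘ subst (y ∈_) (Vec.lookup-replicate x Subset.⊥)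

∅ᴳ-⊆ : ∀ {n} (G : Graph n) → ∅ᴳ ⊆ᴳ G
∅ᴳ-⊆ G = ⊥-elim ∘ Subset.∉⊥ ,
  λ x {y} → ⊥-elim ∘ Subset.∉⊥ ∘ subst (y ∈_) (Vec.lookup-replicate x Subset.⊥)

∅ᴳ-girth : ∀ {n} r → [ r ] ≤⁺ girth (∅ᴳ {n})
∅ᴳ-girth {n} r with girth (∅ᴳ {n}) | proj₂ (∃-girth (∅ᴳ {n}))
... | ⊤⁺    | _ = _ ≤⊤⁺
... | [ g ] | (Z , (V⊆ , _) , isCycle (s≤s _) v _ vs _) , _ =
  contradiction (V⊆ (Equivalence.from (vs _) (Fin.zero , refl))) Subset.∉⊥

abstract
  maxChromatic : ∀ {n} r (G : Graph n) → ∃ (IsMaxChromatic r G)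
  maxChromatic {n} r G =
    let (k , w , max) = greatest
          (λ k → ∃-dec (allGraphs n) allGraphs-complete λ H →
            (H ⊆ᴳ? G) ×-dec (≤⁺-dec ℕ._≤?_ [ r ] (girth H) ×-dec (χ H ℕ.≟ k)))
          n (λ { _ (H , _ , _ , refl) → proj₂ (proj₂ (chromaticNumber H)) n (n-colourable H) })
          (χ (∅ᴳ {n}) , ∅ᴳ , ∅ᴳ-⊆ G , ∅ᴳ-girth {n} r , refl)
    in k , w , λ H H⊆G g → max (χ H) (H , H⊆G , g , refl)

h : ∀ {n} → ℕ → Graph n → ℕ
h r G = proj₁ (maxChromatic r G)

{-# OPTIONS --safe #-}
module Submission where

-- Colour the vertices at random with s colours.  A cycle of length ℓ becomes
-- monochromatic with probability s^(1-ℓ), so some colouring has at most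
-- Σ_ℓ C_ℓ(G) / s^(ℓ-1) monochromatic short cycles, and this is at most m/2 once
-- s is of the order of m / min_ℓ (m^ℓ / (C_ℓ(G)+1))^(1/(ℓ-1)).  Let D contain a vertex
-- of each of them, and let H consist of the edges inside the colour classes that
-- avoid D: its girth is at least r.  Pairs of a colour of H and a colour class,
-- together with a private colour for each vertex of D, colour G properly, whence
-- m ≤ s χ(H) + m/2, that is, χ(H) ≥ m / (2 s).

open import Defs
open import Data.Integer using (+_)
open import Data.List using (applyUpTo)
open import Data.Nat using (ℕ; suc; _+_; _∸_; _^_; _≤_)
open import Data.Product using (∃; _×_)
open import Data.Rational using (_/_)

open import Algebra.Bundles using (CommutativeRing)
open import Algebra.Properties.CommutativeSemiring.Exp using (^-distrib-*)
open import Data.Bool using (Bool; true; false; if_then_else_)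
open import Data.Empty using (⊥-elim)
open import Data.Fin as Fin using (Fin; zero; suc; toℕ; inject₁)
import Data.Fin.Induction as Fin
import Data.Fin.Properties as Fin
open import Data.Fin.Subset using (Subset; inside; outside; _∈_; _-_; ∣_∣; Nonempty)
import Data.Fin.Subset.Properties as Subset
import Data.Integer as ℤ
import Data.Integer.Properties as ℤ
open import Data.List as List using (List; []; _∷_; length)
import Data.List.Properties as List
open import Data.List.Membership.DecPropositional using () renaming (_∈?_ to ∈-dec)
open import Data.List.Membership.Propositional using () renaming (_∈_ to _∈ˡ_; _∉_ to _∉ˡ_)
import Data.List.Membership.Propositional.Properties as List
open import Data.List.Relation.Unary.All as All using (All; []; _∷_)
open import Data.List.Relation.Unary.Any as Any using (here; there)
import Data.List.Relation.Unary.Any.Properties as Any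
open import Data.Nat using (zero; _*_; _<_; z≤n; s≤s; NonZero; >-nonZero; >-nonZero⁻¹)
import Data.Nat.Coprimality as Coprime
import Data.Nat.DivMod as ℕ
import Data.Nat.Properties as ℕ
open import Data.Nat.Tactic.RingSolver using (solve-∀)
open import Data.Product using (_,_; proj₁; proj₂)
open import Data.Rational as ℚ using (ℚ; 0ℚ; 1ℚ)
import Data.Rational.Properties as ℚ
import Data.Rational.Unnormalised as ℚᵘ
import Data.Rational.Unnormalised.Properties as ℚᵘ
open import Data.Sum using (inj₁; inj₂)
open import Data.Vec as Vec using (Vec; []; _∷_; lookup; tabulate; here; there)
import Data.Vec.Properties as Vec
open import Function using (_∘_; _⇔_; mk⇔; Equivalence)
open import Relation.Binary.Construct.Add.Supremum.NonStrict _≤_ using (_≤⁺_; [_]; _≤⊤⁺)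
open import Relation.Binary.Definitions using (Symmetric)
open import Relation.Binary.PropositionalEquality
  using (_≡_; _≢_; refl; sym; trans; cong; subst; subst₂)
open import Relation.Nullary using (Dec; yes; no; does; contradiction; ¬_; ¬?; _×-dec_)
open import Relation.Nullary.Construct.Add.Supremum using (⊤⁺; [_])
open import Relation.Nullary.Decidable using (dec-true)

open import Algebra.Properties.CommutativeSemigroup ℕ.*-commutativeSemigroup
  using (x∙yz≈y∙xz; x∙yz≈xz∙y; interchange)
open import Algebra.Properties.CommutativeMonoid.Sum ℕ.+-0-commutativeMonoid
  using (sum; sum-cong-≗; ∑-distrib-+; sum-replicate-zero)
open import Algebra.Properties.Semiring.Sum ℕ.+-*-semiring using (*-distribʳ-sum)
open import Algebra.Definitions.RawSemiring ℚ.+-*-rawSemiring using () renaming (_^_ to _^ℚ_)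

-- Sums and averages over a finite set of colours.

∑-const : ∀ s {x} → sum {s} (λ _ → x) ≡ s * x
∑-const zero    = refl
∑-const (suc s) {x} = cong (λ t → x + t) (∑-const s)

∑-δ : ∀ {s} (c : Fin s) x → sum (λ d → if does (c Fin.≟ d) then x else 0) ≡ x
∑-δ {suc s} zero    x = trans (cong (λ t → x + t) (sum-replicate-zero s)) (ℕ.+-identityʳ x)
∑-δ {suc s} (suc c) x = ∑-δ c x

∑-average : ∀ s .{{_ : NonZero s}} (g : Fin s → ℕ) {a} → sum g ≤ s * a → ∃ λ i → g i ≤ a
∑-average (suc s) = average s
  where
  average : ∀ s (g : Fin (suc s) → ℕ) {a} → sum g ≤ suc s * a → ∃ λ i → g i ≤ a
  average zero    g le = zero , subst₂ _≤_ (ℕ.+-identityʳ _) (ℕ.+-identityʳ _) le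
  average (suc s) g {a} le with g zero ℕ.≤? a
  ... | yes g₀≤a = zero , g₀≤a
  ... | no  g₀≰a = let (i , gᵢ≤a) = average s (g ∘ suc) (ℕ.+-cancelˡ-≤ a _ _
                         (ℕ.≤-trans (ℕ.+-monoˡ-≤ _ (ℕ.<⇒≤ (ℕ.≰⇒> g₀≰a))) le))
                   in suc i , gᵢ≤a

-- Counting the colourings in which a set is monochromatic.

module _ {s : ℕ} where

  -- Expectations over random colourings are kept as sums over all s^n colourings, so that the
  -- argument stays within the natural numbers.
  sumᵛ : ∀ n → (Vec (Fin s) n → ℕ) → ℕ
  sumᵛ zero    g = g []
  sumᵛ (suc n) g = sum λ c → sumᵛ n λ f → g (c ∷ f)

  sumᵛ-0 : ∀ n → sumᵛ n (λ _ → 0) ≡ 0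
  sumᵛ-0 zero    = refl
  sumᵛ-0 (suc n) = trans (sum-cong-≗ {s} λ _ → sumᵛ-0 n) (sum-replicate-zero s)

  sumᵛ-+ : ∀ n g g′ → sumᵛ n (λ f → g f + g′ f) ≡ sumᵛ n g + sumᵛ n g′
  sumᵛ-+ zero    g g′ = refl
  sumᵛ-+ (suc n) g g′ = trans (sum-cong-≗ {s} λ c → sumᵛ-+ n _ _) (∑-distrib-+ {s} _ _)

  sumᵛ-if : ∀ n b g → sumᵛ n (λ f → if b then g f else 0) ≡ (if b then sumᵛ n g else 0)
  sumᵛ-if n true  g = refl
  sumᵛ-if n false g = sumᵛ-0 n

  -- Method of conditional expectations: the colours are fixed one coordinate at a time, each so
  -- that the average over the remaining coordinates stays at most `a`.
  sumᵛ-average : ∀ n .{{_ : NonZero s}} (g : Vec (Fin s) n → ℕ) {a} →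
                 sumᵛ n g ≤ s ^ n * a → ∃ λ f → g f ≤ a
  sumᵛ-average zero    g le = [] , subst (g [] ≤_) (ℕ.+-identityʳ _) le
  sumᵛ-average (suc n) g {a} le =
    let (c , le′)  = ∑-average s (λ c → sumᵛ n (g ∘ (c ∷_)))
                       (ℕ.≤-trans le (ℕ.≤-reflexive (ℕ.*-assoc s (s ^ n) a)))
        (f , gf≤a) = sumᵛ-average n (g ∘ (c ∷_)) le′
    in c ∷ f , gf≤a

  -- constant and monochromatic take the values 0 and 1, so that sumᵛ counts colourings.
  constant : ∀ {n} → Fin s → Subset n → Vec (Fin s) n → ℕ
  constant c []            []      = 1
  constant c (inside  ∷ S) (d ∷ f) = if does (c Fin.≟ d) then constant c S f else 0
  constant c (outside ∷ S) (_ ∷ f) = constant c S f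

  monochromatic : ∀ {n} → Subset n → Vec (Fin s) n → ℕ
  monochromatic []            []      = 1
  monochromatic (inside  ∷ S) (c ∷ f) = constant c S f
  monochromatic (outside ∷ S) (_ ∷ f) = monochromatic S f

  constant≡1 : ∀ {n c} (S : Subset n) f → (∀ x → x ∈ S → lookup f x ≡ c) → constant c S f ≡ 1
  constant≡1 []            []      eq = refl
  constant≡1 {c = c} (inside ∷ S) (d ∷ f) eq rewrite dec-true (c Fin.≟ d) (sym (eq zero here)) =
    constant≡1 S f (λ x → eq (suc x) ∘ there)
  constant≡1 (outside ∷ S) (_ ∷ f) eq = constant≡1 S f (λ x → eq (suc x) ∘ there)

  monochromatic≡1 : ∀ {n c} (S : Subset n) f → (∀ x → x ∈ S → lookup f x ≡ c) → monochromatic S f ≡ 1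
  monochromatic≡1 []            []      eq = refl
  monochromatic≡1 (inside  ∷ S) (_ ∷ f) eq =
    constant≡1 S f (λ x x∈S → trans (eq (suc x) (there x∈S)) (sym (eq zero here)))
  monochromatic≡1 (outside ∷ S) (_ ∷ f) eq = monochromatic≡1 S f (λ x → eq (suc x) ∘ there)

  -- Each vertex of S has its colour prescribed, which divides the number of colourings by s. The
  -- factor `s ^ ∣ S ∣` on the left replaces these divisions.
  sumᵛ-constant : ∀ {n} c (S : Subset n) → sumᵛ n (constant c S) * s ^ ∣ S ∣ ≡ s ^ n
  sumᵛ-constant c [] = refl
  sumᵛ-constant {suc n} c (inside ∷ S) = let open ℕ.≤-Reasoning in begin-equality
    sum (λ d → sumᵛ n λ f → if does (c Fin.≟ d) then constant c S f else 0) * (s * s ^ ∣ S ∣)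
      ≡⟨ cong (_* (s * s ^ ∣ S ∣)) (trans (sum-cong-≗ {s} λ d → sumᵛ-if n _ _) (∑-δ c _)) ⟩
    sumᵛ n (constant c S) * (s * s ^ ∣ S ∣)
      ≡⟨ x∙yz≈y∙xz (sumᵛ n (constant c S)) s _ ⟩
    s * (sumᵛ n (constant c S) * s ^ ∣ S ∣)
      ≡⟨ cong (s *_) (sumᵛ-constant c S) ⟩
    s * s ^ n ∎
  sumᵛ-constant {suc n} c (outside ∷ S) = let open ℕ.≤-Reasoning in begin-equality
    sum {s} (λ _ → sumᵛ n (constant c S)) * s ^ ∣ S ∣ ≡⟨ cong (_* s ^ ∣ S ∣) (∑-const s) ⟩
    s * sumᵛ n (constant c S) * s ^ ∣ S ∣             ≡⟨ ℕ.*-assoc s _ _ ⟩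
    s * (sumᵛ n (constant c S) * s ^ ∣ S ∣)           ≡⟨ cong (s *_) (sumᵛ-constant c S) ⟩
    s * s ^ n ∎

  -- The first vertex of S takes any of s colours and prescribes those of the others, which gives
  -- equality for nonempty S. The empty set is counted once per colouring rather than once per
  -- colour, hence the inequality.
  sumᵛ-monochromatic : ∀ {n} .{{_ : NonZero s}} (S : Subset n) →
                       sumᵛ n (monochromatic S) * s ^ ∣ S ∣ ≤ s * s ^ n
  sumᵛ-monochromatic [] = subst (1 ≤_) (sym (ℕ.*-identityʳ s)) (>-nonZero⁻¹ s)
  sumᵛ-monochromatic {suc n} (inside ∷ S) = let open ℕ.≤-Reasoning in begin
    sum (λ c → sumᵛ n (constant c S)) * (s * s ^ ∣ S ∣)
      ≡⟨ x∙yz≈y∙xz (sum λ c → sumᵛ n (constant c S)) s _ ⟩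
    s * (sum (λ c → sumᵛ n (constant c S)) * s ^ ∣ S ∣)
      ≡⟨ cong (s *_) (*-distribʳ-sum {s} (s ^ ∣ S ∣) (λ c → sumᵛ n (constant c S))) ⟩
    s * sum (λ c → sumᵛ n (constant c S) * s ^ ∣ S ∣)   ≡⟨ cong (s *_) (sum-cong-≗ {s} λ c → sumᵛ-constant c S) ⟩
    s * sum {s} (λ _ → s ^ n)                           ≡⟨ cong (s *_) (∑-const s) ⟩
    s * (s * s ^ n) ∎
  sumᵛ-monochromatic {suc n} (outside ∷ S) = let open ℕ.≤-Reasoning in begin
    sum {s} (λ _ → sumᵛ n (monochromatic S)) * s ^ ∣ S ∣ ≡⟨ cong (_* s ^ ∣ S ∣) (∑-const s) ⟩
    s * sumᵛ n (monochromatic S) * s ^ ∣ S ∣             ≡⟨ ℕ.*-assoc s _ _ ⟩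
    s * (sumᵛ n (monochromatic S) * s ^ ∣ S ∣)           ≤⟨ ℕ.*-monoʳ-≤ s (sumᵛ-monochromatic S) ⟩
    s * (s * s ^ n) ∎

  monochromatics : ∀ {n} → List (Subset n) → Vec (Fin s) n → ℕ
  monochromatics []       f = 0
  monochromatics (S ∷ Ss) f = monochromatic S f + monochromatics Ss f

  -- Linearity of expectation: a set with more than e vertices is monochromatic with probability at
  -- most s^(-e).
  sumᵛ-monochromatics : ∀ {n} .{{_ : NonZero s}} e (Ss : List (Subset n)) → All (λ S → suc e ≤ ∣ S ∣) Ss →
                        sumᵛ n (monochromatics Ss) * s ^ e ≤ s ^ n * length Ss
  sumᵛ-monochromatics {n} e [] [] rewrite sumᵛ-0 n = z≤n
  sumᵛ-monochromatics {n} e (S ∷ Ss) (e<S ∷ large) = begin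
    sumᵛ n (λ f → monochromatic S f + monochromatics Ss f) * s ^ e
      ≡⟨ cong (_* s ^ e) (sumᵛ-+ n _ _) ⟩
    (sumᵛ n (monochromatic S) + sumᵛ n (monochromatics Ss)) * s ^ e
      ≡⟨ ℕ.*-distribʳ-+ (s ^ e) (sumᵛ n (monochromatic S)) _ ⟩
    sumᵛ n (monochromatic S) * s ^ e + sumᵛ n (monochromatics Ss) * s ^ e
      ≤⟨ ℕ.+-mono-≤ one (sumᵛ-monochromatics e Ss large) ⟩
    s ^ n + s ^ n * length Ss
      ≡⟨ ℕ.*-suc (s ^ n) _ ⟨
    s ^ n * suc (length Ss) ∎
    where
    open ℕ.≤-Reasoning
    one : sumᵛ n (monochromatic S) * s ^ e ≤ s ^ n
    -- Since S has at least e + 1 vertices, a factor s is to spare, and it pays for the choice of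
    -- the common colour.
    one = ℕ.*-cancelˡ-≤ s (begin
      s * (sumᵛ n (monochromatic S) * s ^ e) ≡⟨ x∙yz≈y∙xz (sumᵛ n (monochromatic S)) s _ ⟨
      sumᵛ n (monochromatic S) * s ^ suc e   ≤⟨ ℕ.*-monoʳ-≤ (sumᵛ n (monochromatic S)) (ℕ.^-monoʳ-≤ s e<S) ⟩
      sumᵛ n (monochromatic S) * s ^ ∣ S ∣   ≤⟨ sumᵛ-monochromatic S ⟩
      s * s ^ n ∎)

  -- One vertex is taken from each nonempty monochromatic member of the list, and each such member
  -- contributes 1 to `monochromatics`.
  hittingSet : ∀ {n} (Ss : List (Subset n)) f → ∃ λ (D : List (Fin n)) →
               length D ≤ monochromatics Ss f ×
               (∀ {S} → S ∈ˡ Ss → Nonempty S → monochromatic S f ≡ 1 → ∃ λ x → x ∈ S × x ∈ˡ D)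
  hittingSet []       f = [] , z≤n , λ ()
  hittingSet (S ∷ Ss) f with hittingSet Ss f | Subset.nonempty? S | monochromatic S f ℕ.≟ 1
  ... | D , D≤ , hit | yes (x , x∈S) | yes mono =
    x ∷ D , ℕ.+-mono-≤ (ℕ.≤-reflexive (sym mono)) D≤ , λ
      { (here refl) _ _  → x , x∈S , here refl
      ; (there S∈)  ne m → let (y , y∈S , y∈D) = hit S∈ ne m in y , y∈S , there y∈D }
  ... | D , D≤ , hit | no empty | _ = D , ℕ.m≤n⇒m≤o+n _ D≤ , λ
      { (here refl) ne _ → contradiction ne empty
      ; (there S∈)       → hit S∈ }
  ... | D , D≤ , hit | yes _ | no ¬mono = D , ℕ.m≤n⇒m≤o+n _ D≤ , λ
      { (here refl) _ m → contradiction m ¬mono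
      ; (there S∈)      → hit S∈ }

-- Spanning subgraphs given by a relation on the ends of edges.

∈-tabulate : ∀ {n} {p : Fin n → Bool} {y} → y ∈ tabulate p ⇔ p y ≡ true
∈-tabulate {p = p} {y} = mk⇔
  (λ y∈ → trans (sym (Vec.lookup∘tabulate p y)) (Vec.[]=⇒lookup y∈))
  (λ eq → Vec.lookup⇒[]= y (tabulate p) (trans (Vec.lookup∘tabulate p y) eq))

does⁻ : {A : Set} (a? : Dec A) → does a? ≡ true → A
does⁻ (yes a) _ = a

module Restrict {n} (G : Graph n) {R : Fin n → Fin n → Set}
                (R? : ∀ x y → Dec (R x y)) (R-sym : Symmetric R) where

  private
    adj? : ∀ x y → Dec (Adj G x y × R x y)
    adj? x y = (y Subset.∈? lookup (N G) x) ×-dec R? x y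

    N′ : Vec (Subset n) n
    N′ = tabulate λ x → tabulate λ y → does (adj? x y)

    to : ∀ {x y} → y ∈ lookup N′ x → Adj G x y × R x y
    to {x} {y} y∈ = does⁻ (adj? x y)
      (Equivalence.to ∈-tabulate (subst (y ∈_) (Vec.lookup∘tabulate _ x) y∈))

    from : ∀ {x y} → Adj G x y × R x y → y ∈ lookup N′ x
    from {x} {y} a = subst (y ∈_) (sym (Vec.lookup∘tabulate _ x))
      (Equivalence.from ∈-tabulate (dec-true (adj? x y) a))

  restrict : Graph n
  restrict = mkGraph (V G) N′ (isSimple
    (λ x y xy → let (a , r) = to xy in from (symmetric x y a , R-sym r))
    (λ x xx → irreflexive x (proj₁ (to xx)))
    (λ x y xy → incident x y (proj₁ (to xy))))
    where open IsSimple (simple G)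

  restrict-adj : ∀ {x y} → Adj restrict x y ⇔ (Adj G x y × R x y)
  restrict-adj = mk⇔ to from

  restrict-⊆ : restrict ⊆ᴳ G
  restrict-⊆ = (λ x∈ → x∈) , λ x → proj₁ ∘ to

-- Girth and the structure of cycles.

⊆ᴳ-trans : ∀ {n} {F G H : Graph n} → F ⊆ᴳ G → G ⊆ᴳ H → F ⊆ᴳ H
⊆ᴳ-trans (V⊆ , N⊆) (V⊆′ , N⊆′) = V⊆′ ∘ V⊆ , λ x → N⊆′ x ∘ N⊆ x

≤-girth : ∀ {n} r (G : Graph n) → (∀ ℓ → ℓ < r → ¬ HasCycle G ℓ) → [ r ] ≤⁺ girth G
≤-girth r G none with girth G | proj₂ (∃-girth G)
... | ⊤⁺    | _       = _ ≤⊤⁺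
... | [ g ] | cyc , _ = [ ℕ.≮⇒≥ (λ g<r → none g g<r cyc) ]

injective⇒≤∣∣ : ∀ {n ℓ} (S : Subset n) (v : Fin ℓ → Fin n) → (∀ i j → v i ≡ v j → i ≡ j) →
                (∀ i → v i ∈ S) → ℓ ≤ ∣ S ∣
injective⇒≤∣∣ {ℓ = zero}  S v inj v∈S = z≤n
injective⇒≤∣∣ {ℓ = suc ℓ} S v inj v∈S = ℕ.≤-trans
  (s≤s (injective⇒≤∣∣ (S - v zero) (v ∘ suc)
    (λ i j e → Fin.suc-injective (inj _ _ e))
    (λ i → Subset.x∈p∧x≢y⇒x∈p-y (v∈S (suc i)) (λ e → Fin.0≢1+n (sym (inj _ _ e))))))
  (Subset.x∈p⇒∣p-x∣<∣p∣ (v∈S zero))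

locallyConstant⇒constant : ∀ {A : Set} {ℓ} (g : Fin (suc ℓ) → A) →
                           (∀ i j → Consecutive i j → g i ≡ g j) → ∀ i → g i ≡ g zero
locallyConstant⇒constant g eq = Fin.<-weakInduction (λ i → g i ≡ g zero) refl λ i e →
  trans (sym (eq (inject₁ i) (suc i) (inj₁ (cong suc (Fin.toℕ-inject₁ i))))) e

module _ {n} {Z : Graph n} where

  cycle-∣V∣ : ∀ {ℓ} → IsCycle ℓ Z → ℓ ≤ ∣ V Z ∣
  cycle-∣V∣ (isCycle _ v inj vs _) =
    injective⇒≤∣∣ (V Z) (lookup v) inj (λ i → Equivalence.from (vs _) (i , refl))

  cycle-nonempty : ∀ {ℓ} → IsCycle ℓ Z → Nonempty (V Z)
  cycle-nonempty (isCycle (s≤s _) v _ vs _) = lookup v zero , Equivalence.from (vs _) (zero , refl)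

  -- Equality propagates along consecutive vertices. With a colouring for `g`, a cycle all of whose
  -- edges lie inside colour classes is monochromatic.
  cycle-constant : ∀ {ℓ} {A : Set} (g : Fin n → A) → IsCycle ℓ Z → (∀ x y → Adj Z x y → g x ≡ g y) →
                   ∃ λ c → ∀ x → x ∈ V Z → g x ≡ c
  cycle-constant g (isCycle (s≤s _) v _ vs es) eq = g (lookup v zero) , λ x x∈ →
    let (i , vᵢ≡x) = Equivalence.to (vs x) x∈ in
    trans (cong g (sym vᵢ≡x)) (locallyConstant⇒constant (g ∘ lookup v)
      (λ i j c → eq _ _ (Equivalence.from (es i j) (inj₁ c))) i)

  -- Serves to show that a cycle avoids every vertex that has lost all its edges. At the last index
  -- the neighbour is the first vertex of the cycle.
  cycle-neighbour : ∀ {ℓ x} → IsCycle ℓ Z → x ∈ V Z → ∃ λ y → Adj Z x y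
  cycle-neighbour {ℓ = ℓ@(suc _)} {x} (isCycle _ v _ vs es) x∈ with Equivalence.to (vs x) x∈
  ... | i , refl with suc (toℕ i) ℕ.<? ℓ
  ...   | yes lt = lookup v (Fin.fromℕ< lt) ,
                   Equivalence.from (es _ _) (inj₁ (inj₁ (sym (Fin.toℕ-fromℕ< lt))))
  ...   | no ¬lt = lookup v zero ,
                   Equivalence.from (es _ _) (inj₁ (inj₂ (ℕ.≤∧≮⇒≡ (Fin.toℕ<n i) ¬lt , refl)))

-- Colouring G from a colouring of the subgraph.

mixed-radix-injective : ∀ {s a b} (i j : Fin s) → a * s + toℕ i ≡ b * s + toℕ j → a ≡ b × i ≡ j
mixed-radix-injective {s@(suc _)} {a} {b} i j e = a≡b , i≡j
  where
  remainder : ∀ a (i : Fin s) → (a * s + toℕ i) ℕ.% s ≡ toℕ i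
  remainder a i = trans (cong (ℕ._% s) (ℕ.+-comm (a * s) (toℕ i)))
    (trans (ℕ.[m+kn]%n≡m%n (toℕ i) a s) (ℕ.m<n⇒m%n≡m (Fin.toℕ<n i)))
  i≡j : i ≡ j
  i≡j = Fin.toℕ-injective (trans (sym (remainder a i)) (trans (cong (ℕ._% s) e) (remainder b j)))
  a≡b : a ≡ b
  a≡b = ℕ.*-cancelʳ-≡ a b s (ℕ.+-cancelʳ-≡ (toℕ i) _ _
    (trans e (cong (λ k → b * s + toℕ k) (sym i≡j))))

χ-least : ∀ {n k} (G : Graph n) → Colourable k G → χ G ≤ k
χ-least G = proj₂ (proj₂ (chromaticNumber G)) _

module Split {n s} (G : Graph n) (f : Vec (Fin s) n) (D : List (Fin n)) where

  private
    _∈D? : ∀ x → Dec (x ∈ˡ D)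
    x ∈D? = ∈-dec Fin._≟_ x D

  -- Vertices of D are not deleted but isolated, so a condition on edges alone describes the
  -- subgraph.
  open Restrict G {R = λ x y → lookup f x ≡ lookup f y × x ∉ˡ D × y ∉ˡ D}
    (λ x y → (lookup f x Fin.≟ lookup f y) ×-dec (¬? (x ∈D?) ×-dec ¬? (y ∈D?)))
    (λ (e , x∉ , y∉) → sym e , y∉ , x∉)
    public

  index-injective : ∀ {x y} (p : x ∈ˡ D) (q : y ∈ˡ D) → Any.index p ≡ Any.index q → x ≡ y
  index-injective p q e =
    trans (Any.lookup-index p) (trans (cong (List.lookup D) e) (sym (Any.lookup-index q)))

  -- Colours below `k * s` encode pairs of a colour and a class in base s; those from `k * s` on are
  -- positions in D. An edge outside D whose ends received the same pair would lie in one class,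
  -- hence in `restrict`, where `c` is proper.
  colourable : ∀ {k} → Colourable k restrict → Colourable (k * s + length D) G
  colourable {k} (c , c<k , proper) = colour , bounded′ , proper′
    where
    open IsSimple (simple G)
    colour : Fin n → ℕ
    colour x with x ∈D?
    ... | yes p = k * s + toℕ (Any.index p)
    ... | no  _ = c x * s + toℕ (lookup f x)

    small : ∀ x → x ∈ V G → c x * s + toℕ (lookup f x) < k * s
    small x x∈ = ℕ.<-≤-trans (ℕ.+-monoʳ-< (c x * s) (Fin.toℕ<n (lookup f x)))
      (subst (_≤ k * s) (ℕ.+-comm s (c x * s)) (ℕ.*-monoˡ-≤ s (c<k x x∈)))

    bounded′ : ∀ x → x ∈ V G → colour x < k * s + length D
    bounded′ x x∈ with x ∈D?
    ... | yes p = ℕ.+-monoʳ-< (k * s) (Fin.toℕ<n (Any.index p))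
    ... | no  _ = ℕ.<-≤-trans (small x x∈) (ℕ.m≤m+n _ _)

    proper′ : ∀ x y → Adj G x y → colour x ≢ colour y
    proper′ x y xy e with x ∈D? | y ∈D?
    ... | yes p | yes q with index-injective p q (Fin.toℕ-injective (ℕ.+-cancelˡ-≡ (k * s) _ _ e))
    ...   | refl = irreflexive x xy
    proper′ x y xy e | yes p | no  _ =
      ℕ.<⇒≱ (small y (incident y x (symmetric x y xy))) (subst (k * s ≤_) e (ℕ.m≤m+n _ _))
    proper′ x y xy e | no  _ | yes q =
      ℕ.<⇒≱ (small x (incident x y xy)) (subst (k * s ≤_) (sym e) (ℕ.m≤m+n _ _))
    proper′ x y xy e | no x∉ | no y∉ =
      let (cx≡cy , fx≡fy) = mixed-radix-injective (lookup f x) (lookup f y) e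
      in proper x y (Equivalence.from restrict-adj (xy , fx≡fy , x∉ , y∉)) cx≡cy

-- A colouring with few monochromatic short cycles.

module _ {n s : ℕ} where

  sumᵛ-monochromatics-++ : ∀ (Ss Ts : List (Subset n)) →
    sumᵛ {s} n (monochromatics (Ss List.++ Ts)) ≡
    sumᵛ {s} n (monochromatics Ss) + sumᵛ {s} n (monochromatics Ts)
  sumᵛ-monochromatics-++ []       Ts = cong (_+ sumᵛ {s} n (monochromatics Ts)) (sym (sumᵛ-0 {s} n))
  sumᵛ-monochromatics-++ (S ∷ Ss) Ts = let open ℕ.≤-Reasoning in begin-equality
    sumᵛ n (λ f → monochromatic S f + monochromatics (Ss List.++ Ts) f)
      ≡⟨ sumᵛ-+ n _ _ ⟩
    sumᵛ n (monochromatic S) + sumᵛ n (monochromatics (Ss List.++ Ts))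
      ≡⟨ cong (λ t → sumᵛ {s} n (monochromatic S) + t) (sumᵛ-monochromatics-++ Ss Ts) ⟩
    sumᵛ n (monochromatic S) + (sumᵛ n (monochromatics Ss) + sumᵛ n (monochromatics Ts))
      ≡⟨ ℕ.+-assoc (sumᵛ n (monochromatic S)) _ _ ⟨
    sumᵛ n (monochromatic S) + sumᵛ n (monochromatics Ss) + sumᵛ n (monochromatics Ts)
      ≡⟨ cong (_+ sumᵛ n (monochromatics Ts)) (sumᵛ-+ n _ _) ⟨
    sumᵛ n (λ f → monochromatic S f + monochromatics Ss f) + sumᵛ n (monochromatics Ts) ∎

  -- Every list, later one for each cycle length, gets the same share b / a of the total; `a` stays
  -- on the left to avoid division.
  sumᵛ-monochromatics-concat : ∀ k (F : ℕ → List (Subset n)) {a b} →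
    (∀ i → i < k → a * sumᵛ {s} n (monochromatics (F i)) ≤ b) →
    a * sumᵛ {s} n (monochromatics (List.concat (applyUpTo F k))) ≤ k * b
  sumᵛ-monochromatics-concat zero    F {a} le rewrite sumᵛ-0 {s} n | ℕ.*-zeroʳ a = z≤n
  sumᵛ-monochromatics-concat (suc k) F {a} {b} le = let open ℕ.≤-Reasoning in begin
    a * sumᵛ n (monochromatics (F 0 List.++ rest))
      ≡⟨ cong (a *_) (sumᵛ-monochromatics-++ (F 0) rest) ⟩
    a * (sumᵛ n (monochromatics (F 0)) + sumᵛ n (monochromatics rest))
      ≡⟨ ℕ.*-distribˡ-+ a (sumᵛ n (monochromatics (F 0))) _ ⟩
    a * sumᵛ n (monochromatics (F 0)) + a * sumᵛ n (monochromatics rest)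
      ≤⟨ ℕ.+-mono-≤ (le 0 (s≤s z≤n))
           (sumᵛ-monochromatics-concat k (F ∘ suc) {a} (λ i i<k → le (suc i) (s≤s i<k))) ⟩
    b + k * b ∎
    where rest = List.concat (applyUpTo (F ∘ suc) k)

-- Here r = 3 + j, and i < j indexes the lengths ℓ = 3 + i. By `few`, on average at most m / (2 j)
-- cycles of each length are monochromatic, where m is `χ G`, so at most m / 2 over all j lengths.
module Sparsify {n s} .{{_ : NonZero s}} (j : ℕ) .{{_ : NonZero j}} (G : Graph n)
  (few : ∀ i → i < j → 2 * j * C (3 + i) G ≤ s ^ (2 + i) * χ G) where

  private
    -- Cycles with the same vertices contribute repeated entries, so the list has length exactly
    -- `C (3 + i) G`.
    vertexSets : ℕ → List (Subset n)
    vertexSets i = List.map V (proj₁ (cycles (3 + i) G))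

    Ss : List (Subset n)
    Ss = List.concat (applyUpTo vertexSets j)

    large : ∀ i → All (λ S → 3 + i ≤ ∣ S ∣) (vertexSets i)
    large i = All.tabulate λ S∈ → let (Z , Z∈ , S≡) = List.∈-map⁻ V S∈ in
      subst (λ S → 3 + i ≤ ∣ S ∣) (sym S≡)
        (cycle-∣V∣ (proj₂ (Equivalence.to (proj₂ (proj₂ (cycles (3 + i) G)) Z) Z∈)))

    fewᵢ : ∀ i → i < j → 2 * j * sumᵛ {s} n (monochromatics (vertexSets i)) ≤ s ^ n * χ G
    fewᵢ i i<j = ℕ.*-cancelʳ-≤ _ _ (s ^ (2 + i)) {{ℕ.m^n≢0 s (2 + i)}} (begin
      2 * j * sumᵛ n (monochromatics (vertexSets i)) * s ^ (2 + i)
        ≡⟨ ℕ.*-assoc (2 * j) _ (s ^ (2 + i)) ⟩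
      2 * j * (sumᵛ n (monochromatics (vertexSets i)) * s ^ (2 + i))
        ≤⟨ ℕ.*-monoʳ-≤ (2 * j) (sumᵛ-monochromatics (2 + i) (vertexSets i) (large i)) ⟩
      2 * j * (s ^ n * length (vertexSets i))
        ≡⟨ cong (λ t → 2 * j * (s ^ n * t)) (List.length-map V (proj₁ (cycles (3 + i) G))) ⟩
      2 * j * (s ^ n * C (3 + i) G)
        ≡⟨ x∙yz≈y∙xz (2 * j) (s ^ n) _ ⟩
      s ^ n * (2 * j * C (3 + i) G)
        ≤⟨ ℕ.*-monoʳ-≤ (s ^ n) (few i i<j) ⟩
      s ^ n * (s ^ (2 + i) * χ G)
        ≡⟨ x∙yz≈xz∙y (s ^ n) (s ^ (2 + i)) _ ⟩
      s ^ n * χ G * s ^ (2 + i) ∎)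
      where
      open ℕ.≤-Reasoning

    -- The number is doubled because half of `χ G` need not be an integer.
    good : ∃ λ (f : Vec (Fin s) n) → monochromatics Ss f + monochromatics Ss f ≤ χ G
    good = sumᵛ-average n _ (ℕ.*-cancelˡ-≤ j (begin
      j * sumᵛ n (λ f → monochromatics Ss f + monochromatics Ss f) ≡⟨ cong (j *_) (sumᵛ-+ n _ _) ⟩
      j * (sumᵛ n (monochromatics Ss) + sumᵛ n (monochromatics Ss)) ≡⟨ double j _ ⟩
      2 * j * sumᵛ n (monochromatics Ss) ≤⟨ sumᵛ-monochromatics-concat j vertexSets {2 * j} fewᵢ ⟩
      j * (s ^ n * χ G) ∎))
      where
      open ℕ.≤-Reasoning
      double : ∀ a b → a * (b + b) ≡ 2 * a * b
      double = solve-∀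

    f : Vec (Fin s) n
    f = proj₁ good

    D : List (Fin n)
    D = proj₁ (hittingSet Ss f)

    ∣D∣≤ : length D ≤ monochromatics Ss f
    ∣D∣≤ = proj₁ (proj₂ (hittingSet Ss f))

    open Split G f D

    -- A short cycle of `restrict` is monochromatic and also a cycle of G, so it meets D; but its
    -- edges avoid D.
    noShortCycle : ∀ ℓ → ℓ < 3 + j → ¬ HasCycle restrict ℓ
    noShortCycle (suc (suc (suc i))) (s≤s (s≤s (s≤s i<j))) (Z , Z⊆H , cyc) =
      let (c , f≡c) = cycle-constant (lookup f) cyc
            (λ x y xy → proj₁ (proj₂ (adj xy)))
          Z∈ = Equivalence.from (proj₂ (proj₂ (cycles (3 + i) G)) Z)
                 (⊆ᴳ-trans {F = Z} {restrict} {G} Z⊆H restrict-⊆ , cyc)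
          S∈ = List.∈-concat⁺′ (List.∈-map⁺ V Z∈) (List.∈-applyUpTo⁺ vertexSets i<j)
          (x , x∈Z , x∈D) = proj₂ (proj₂ (hittingSet Ss f)) S∈ (cycle-nonempty cyc)
                              (monochromatic≡1 (V Z) f f≡c)
          (y , xy) = cycle-neighbour cyc x∈Z
      in proj₁ (proj₂ (proj₂ (adj xy))) x∈D
      where
      adj : ∀ {x y} → Adj Z x y → Adj G x y × lookup f x ≡ lookup f y × x ∉ˡ D × y ∉ˡ D
      adj {x} xy = Equivalence.to restrict-adj (proj₂ Z⊆H x xy)
    noShortCycle 0 _ (Z , _ , isCycle () _ _ _ _)
    noShortCycle 1 _ (Z , _ , isCycle (s≤s ()) _ _ _ _)
    noShortCycle 2 _ (Z , _ , isCycle (s≤s (s≤s ())) _ _ _ _)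

  χ≤ : χ G ≤ 2 * (h (3 + j) G * s)
  -- The bound χ G ≤ k s + |D| is doubled; as 2 |D| ≤ χ G, one copy of `χ G` cancels.
  χ≤ = ℕ.+-cancelʳ-≤ (χ G) _ _ (begin
    χ G + χ G ≤⟨ ℕ.+-mono-≤ split split ⟩
    (k * s + length D) + (k * s + length D) ≡⟨ regroup (k * s) (length D) ⟩
    2 * (k * s) + (length D + length D)
      ≤⟨ ℕ.+-monoʳ-≤ (2 * (k * s)) (ℕ.≤-trans (ℕ.+-mono-≤ ∣D∣≤ ∣D∣≤) (proj₂ good)) ⟩
    2 * (k * s) + χ G ≤⟨ ℕ.+-monoˡ-≤ (χ G) (ℕ.*-monoʳ-≤ 2 (ℕ.*-monoˡ-≤ s χH≤h)) ⟩
    2 * (h (3 + j) G * s) + χ G ∎)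
    where
    open ℕ.≤-Reasoning
    k = χ restrict
    split : χ G ≤ k * s + length D
    split = χ-least G (colourable (proj₁ (proj₂ (chromaticNumber restrict))))
    χH≤h : k ≤ h (3 + j) G
    χH≤h = proj₂ (proj₂ (maxChromatic (3 + j) G)) restrict restrict-⊆
             (≤-girth (3 + j) restrict noShortCycle)
    regroup : ∀ a b → (a + b) + (a + b) ≡ 2 * a + (b + b)
    regroup = solve-∀

-- Choice of the number of colours.

^-distribʳ-* : ∀ a b k → (a * b) ^ k ≡ a ^ k * b ^ k
^-distribʳ-* a b zero    = refl
^-distribʳ-* a b (suc k) =
  trans (cong (a * b *_) (^-distribʳ-* a b k)) (interchange a b (a ^ k) (b ^ k))

-- For b = p / d and ℓ = 2 + e the hypotheses read s ≥ K m / b and b^(ℓ-1) ≤ m^ℓ / (c + 1). Hence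
-- s^(ℓ-1) m ≥ K^(ℓ-1) (c + 1) ≥ K c. The proof multiplies by (m d)^(ℓ-1) to clear denominators.
cycle-budget : ∀ e {K m p d s c} .{{_ : NonZero K}} .{{_ : NonZero m}} .{{_ : NonZero d}} →
               K * (m * d) ≤ s * p → p ^ suc e * suc c ≤ m ^ (2 + e) * d ^ suc e →
               K * c ≤ s ^ suc e * m
cycle-budget e {K} {m} {p} {d} {s} {c} Kmd≤sp short =
  ℕ.*-cancelʳ-≤ _ _ ((m * d) ^ E) {{ℕ.m^n≢0 (m * d) E {{ℕ.m*n≢0 m d}}}} (begin
    K * c * (m * d) ^ E
      ≤⟨ ℕ.*-monoˡ-≤ _ (ℕ.*-mono-≤ (ℕ.m≤m*n K (K ^ e) {{ℕ.m^n≢0 K e}}) (ℕ.n≤1+n c)) ⟩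
    K ^ E * suc c * (m * d) ^ E
      ≡⟨ x∙yz≈xz∙y (K ^ E) ((m * d) ^ E) (suc c) ⟨
    K ^ E * ((m * d) ^ E * suc c)
      ≡⟨ ℕ.*-assoc (K ^ E) _ (suc c) ⟨
    K ^ E * (m * d) ^ E * suc c
      ≡⟨ cong (_* suc c) (^-distribʳ-* K (m * d) E) ⟨
    (K * (m * d)) ^ E * suc c
      ≤⟨ ℕ.*-monoˡ-≤ (suc c) (ℕ.^-monoˡ-≤ E Kmd≤sp) ⟩
    (s * p) ^ E * suc c
      ≡⟨ cong (_* suc c) (^-distribʳ-* s p E) ⟩
    s ^ E * p ^ E * suc c
      ≡⟨ ℕ.*-assoc (s ^ E) (p ^ E) (suc c) ⟩
    s ^ E * (p ^ E * suc c)
      ≤⟨ ℕ.*-monoʳ-≤ (s ^ E) short ⟩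
    s ^ E * (m * m ^ E * d ^ E)
      ≡⟨ cong (s ^ E *_) (trans (ℕ.*-assoc m _ _) (cong (m *_) (sym (^-distribʳ-* m d E)))) ⟩
    s ^ E * (m * (m * d) ^ E)
      ≡⟨ ℕ.*-assoc (s ^ E) m _ ⟨
    s ^ E * m * (m * d) ^ E ∎)
  where
  open ℕ.≤-Reasoning
  E = suc e

module _ {n} (G : Graph n) (j p d : ℕ) .{{_ : NonZero j}} .{{_ : NonZero p}} .{{_ : NonZero d}} where

  -- The number of colours is s ≈ 2 j m d / p.
  ≤-h : p < χ G * d →
        (∀ i → i < j → p ^ (2 + i) * suc (C (3 + i) G) ≤ χ G ^ (3 + i) * d ^ (2 + i)) →
        p ≤ 2 * suc (2 * j) * h (3 + j) G * d
  ≤-h p<md short = ℕ.*-cancelʳ-≤ _ _ s (begin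
    p * s                             ≡⟨ ℕ.*-comm p s ⟩
    -- Rounding up to `s = suc q` costs one further p, which p < m d absorbs: K becomes `suc K`.
    p + q * p                         ≤⟨ ℕ.+-mono-≤ (ℕ.<⇒≤ p<md) (ℕ.m/n*n≤m (K * (m * d)) p) ⟩
    suc K * (m * d)                   ≤⟨ ℕ.*-monoʳ-≤ (suc K) (ℕ.*-monoˡ-≤ d χ≤) ⟩
    suc K * (2 * (h (3 + j) G * s) * d) ≡⟨ regroup K (h (3 + j) G) s d ⟩
    2 * suc K * h (3 + j) G * d * s   ∎)
    where
    open ℕ.≤-Reasoning
    m = χ G
    K = 2 * j
    q = (K * (m * d)) ℕ./ p
    s = suc q
    instance
      K≢0 : NonZero K
      K≢0 = ℕ.m*n≢0 2 j
      m≢0 : NonZero m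
      m≢0 = ℕ.m*n≢0⇒m≢0 m {d} {{>-nonZero (ℕ.≤-<-trans z≤n p<md)}}
    Kmd≤sp : K * (m * d) ≤ s * p
    Kmd≤sp = begin
      K * (m * d)                     ≡⟨ ℕ.m≡m%n+[m/n]*n (K * (m * d)) p ⟩
      (K * (m * d)) ℕ.% p + q * p     ≤⟨ ℕ.+-monoˡ-≤ (q * p) (ℕ.m%n≤n (K * (m * d)) p) ⟩
      s * p                           ∎
    open Sparsify {s = s} j G (λ i i<j → cycle-budget (suc i) {K} {m} {p} {d} {s} Kmd≤sp (short i i<j))
    regroup : ∀ k x s d → suc k * (2 * (x * s) * d) ≡ 2 * suc k * x * d * s
    regroup = solve-∀

-- Natural numbers and fractions inside the rationals.

ι : ℕ → ℚ
ι n = + n / 1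

-- With numerator and denominator explicit, comparing such rationals amounts to comparing
-- numerators.
ι≡mkℚ : ∀ n → ι n ≡ ℚ.mkℚ (+ n) 0 (Coprime.sym (Coprime.1-coprimeTo n))
ι≡mkℚ n = ℚ.normalize-coprime (Coprime.sym (Coprime.1-coprimeTo n))

ι-mono-≤ : ∀ {a b} → a ≤ b → ι a ℚ.≤ ι b
ι-mono-≤ {a} {b} a≤b = subst₂ ℚ._≤_ (sym (ι≡mkℚ a)) (sym (ι≡mkℚ b))
  (ℚ.*≤* (ℤ.*-monoʳ-≤-nonNeg (+ 1) (ℤ.+≤+ a≤b)))

ι-cancel-< : ∀ {a b} → ι a ℚ.< ι b → a < b
ι-cancel-< {a} {b} a<b with subst₂ ℚ._<_ (ι≡mkℚ a) (ι≡mkℚ b) a<b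
... | ℚ.*<* lt = ℤ.drop‿+<+ (ℤ.*-cancelʳ-<-nonNeg (+ 1) lt)

ι-pos : ∀ n .{{_ : NonZero n}} → ℚ.Positive (ι n)
ι-pos n = ℚ.normalize-pos n 1

-- A quotient `_/_` is `fromℚᵘ` of an unreduced fraction, so identities between products of
-- quotients can be checked before reduction to lowest terms.
fromℚᵘ-homo-* : ∀ p q → ℚ.fromℚᵘ (p ℚᵘ.* q) ≡ ℚ.fromℚᵘ p ℚ.* ℚ.fromℚᵘ q
fromℚᵘ-homo-* p q = ℚ.toℚᵘ-injective (begin
  ℚ.toℚᵘ (ℚ.fromℚᵘ (p ℚᵘ.* q))                     ≈⟨ ℚ.toℚᵘ-fromℚᵘ (p ℚᵘ.* q) ⟩
  p ℚᵘ.* q                                           ≈⟨ ℚᵘ.*-cong (ℚ.toℚᵘ-fromℚᵘ p) (ℚ.toℚᵘ-fromℚᵘ q) ⟨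
  ℚ.toℚᵘ (ℚ.fromℚᵘ p) ℚᵘ.* ℚ.toℚᵘ (ℚ.fromℚᵘ q)    ≈⟨ ℚ.toℚᵘ-homo-* (ℚ.fromℚᵘ p) (ℚ.fromℚᵘ q) ⟨
  ℚ.toℚᵘ (ℚ.fromℚᵘ p ℚ.* ℚ.fromℚᵘ q)               ∎)
  where open ℚᵘ.≃-Reasoning

ι-homo-* : ∀ a b → ι (a * b) ≡ ι a ℚ.* ι b
ι-homo-* a b = trans (cong (_/ 1) (ℤ.pos-* a b)) (fromℚᵘ-homo-* (ℚᵘ.mkℚᵘ (+ a) 0) (ℚᵘ.mkℚᵘ (+ b) 0))

ι-homo-^ : ∀ a k → ι (a ^ k) ≡ ι a ^ℚ k
ι-homo-^ a zero    = refl
ι-homo-^ a (suc k) = trans (ι-homo-* a (a ^ k)) (cong (ι a ℚ.*_) (ι-homo-^ a k))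

/-*-cancel : ∀ a d .{{_ : NonZero d}} → (+ a / d) ℚ.* ι d ≡ ι a
/-*-cancel a d@(suc d-1) = trans
  (sym (fromℚᵘ-homo-* (ℚᵘ.mkℚᵘ (+ a) d-1) (ℚᵘ.mkℚᵘ (+ d) 0)))
  (ℚ.fromℚᵘ-cong {ℚᵘ.mkℚᵘ (+ a) d-1 ℚᵘ.* ℚᵘ.mkℚᵘ (+ d) 0} {ℚᵘ.mkℚᵘ (+ a) 0}
    (ℚᵘ.*≡* (trans (ℤ.*-identityʳ _) (cong (λ k → + a ℤ.* + k) (sym (ℕ.*-identityʳ d))))))

1/-*-cancel : ∀ d a .{{_ : NonZero d}} → (+ 1 / d) ℚ.* ι (d * a) ≡ ι a
1/-*-cancel d a = begin-equality
  (+ 1 / d) ℚ.* ι (d * a)       ≡⟨ cong ((+ 1 / d) ℚ.*_) (ι-homo-* d a) ⟩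
  (+ 1 / d) ℚ.* (ι d ℚ.* ι a)   ≡⟨ ℚ.*-assoc (+ 1 / d) (ι d) (ι a) ⟨
  (+ 1 / d) ℚ.* ι d ℚ.* ι a     ≡⟨ cong (ℚ._* ι a) (/-*-cancel 1 d) ⟩
  1ℚ ℚ.* ι a                    ≡⟨ ℚ.*-identityˡ (ι a) ⟩
  ι a                           ∎
  where open ℚ.≤-Reasoning

-- From rationals in the cut to the bound on h.

minimum-L : ∀ {x q} k (F : ℕ → ℝ) → L (minimum x (applyUpTo F k)) q → L x q × (∀ i → i < k → L (F i) q)
minimum-L zero    F q∈ = q∈ , λ _ ()
minimum-L (suc k) F (q∈₀ , q∈) = let (q∈x , q∈F) = minimum-L k (F ∘ suc) q∈ in
  q∈x , λ { zero _ → q∈₀ ; (suc i) (s≤s i<k) → q∈F i i<k }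

module _ {n} (G : Graph n) (j : ℕ) .{{_ : NonZero j}} where

  private
    m = χ G
    -- The factor 2 comes from `χ≤`, and `suc (2 * j)` from the number of colours after rounding up.
    k = 2 * suc (2 * j)
    bound = minimum (fromℕ m)
      (applyUpTo (λ i → root (2 + i) (fromℚ (+ (m ^ (3 + i)) / suc (C (3 + i) G)))) j)

  -- Writing b as p / d turns its membership in the cut into the natural-number hypotheses of `≤-h`.
  -- Positivity of b makes p nonzero, as the division defining the number of colours requires.
  bound⇒≤-h : ∀ {b} → 0ℚ ℚ.< b →
             L bound b → b ℚ.≤ ι (k * h (3 + j) G)
  bound⇒≤-h {ℚ.mkℚ ℤ.+0 _ _} (ℚ.*<* (ℤ.+<+ ())) _
  bound⇒≤-h {ℚ.mkℚ (ℤ.-[1+ _ ]) _ _} (ℚ.*<* ()) _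
  bound⇒≤-h {b@(ℚ.mkℚ (+ p@(suc _)) d-1 _)} 0<b b∈ =
    ℚ.*-cancelʳ-≤-pos (ι d) {{ι-pos d}} (subst₂ ℚ._≤_ (sym b*d≡p) (ι-homo-* (k * h (3 + j) G) d)
      (ι-mono-≤ (≤-h G j p d p<md short)))
    where
    d = suc d-1
    b*d≡p : b ℚ.* ι d ≡ ι p
    b*d≡p = trans (cong (ℚ._* ι d) (sym (ℚ.↥p/↧p≡p b))) (/-*-cancel p d)
    p<md : p < m * d
    p<md = ι-cancel-< (subst₂ ℚ._<_ b*d≡p (sym (ι-homo-* m d))
      (ℚ.*-monoˡ-<-pos (ι d) {{ι-pos d}} (proj₁ (minimum-L j _ b∈))))
    short : ∀ i → i < j → p ^ (2 + i) * suc (C (3 + i) G) ≤ m ^ (3 + i) * d ^ (2 + i)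
    short i i<j with proj₂ (minimum-L j _ b∈) i i<j
    -- The cut of a root contains every negative rational by convention.
    ... | inj₁ b<0  = ⊥-elim (ℚ.<-asym b<0 0<b)
    -- Multiplication of b^e < x by d^e c clears both denominators.
    ... | inj₂ bᵉ<x = ℕ.<⇒≤ (ι-cancel-< (begin-strict
      ι (p ^ e * c)                   ≡⟨ ι-homo-* (p ^ e) c ⟩
      ι (p ^ e) ℚ.* ι c               ≡⟨ cong (ℚ._* ι c) p^e ⟩
      b ^ℚ e ℚ.* ι (d ^ e) ℚ.* ι c    <⟨ ℚ.*-monoˡ-<-pos (ι c) {{ι-pos c}}
                                           (ℚ.*-monoˡ-<-pos (ι (d ^ e)) {{ι-pos (d ^ e) {{ℕ.m^n≢0 d e}}}} bᵉ<x) ⟩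
      x ℚ.* ι (d ^ e) ℚ.* ι c         ≡⟨ ℚ.*-assoc x (ι (d ^ e)) (ι c) ⟩
      x ℚ.* (ι (d ^ e) ℚ.* ι c)       ≡⟨ cong (x ℚ.*_) (ℚ.*-comm (ι (d ^ e)) (ι c)) ⟩
      x ℚ.* (ι c ℚ.* ι (d ^ e))       ≡⟨ ℚ.*-assoc x (ι c) (ι (d ^ e)) ⟨
      x ℚ.* ι c ℚ.* ι (d ^ e)         ≡⟨ cong (ℚ._* ι (d ^ e)) (/-*-cancel (m ^ (3 + i)) c) ⟩
      ι (m ^ (3 + i)) ℚ.* ι (d ^ e)   ≡⟨ ι-homo-* (m ^ (3 + i)) (d ^ e) ⟨
      ι (m ^ (3 + i) * d ^ e)         ∎))
      where
      open ℚ.≤-Reasoning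
      e = 2 + i
      c = suc (C (3 + i) G)
      x = + (m ^ (3 + i)) / c
      p^e : ι (p ^ e) ≡ b ^ℚ e ℚ.* ι (d ^ e)
      p^e = begin-equality
        ι (p ^ e)              ≡⟨ ι-homo-^ p e ⟩
        ι p ^ℚ e               ≡⟨ cong (_^ℚ e) b*d≡p ⟨
        (b ℚ.* ι d) ^ℚ e
                               ≡⟨ ^-distrib-* (CommutativeRing.commutativeSemiring ℚ.+-*-commutativeRing) b (ι d) e ⟩
        b ^ℚ e ℚ.* ι d ^ℚ e    ≡⟨ cong (b ^ℚ e ℚ.*_) (ι-homo-^ d e) ⟨
        b ^ℚ e ℚ.* ι (d ^ e)   ∎

  -- The cut has no largest element, so b may be enlarged to a positive b′.
  scaled-minimum≤h : fromℚ (+ 1 / k) *ℝ bound ≤ℝ fromℕ (h (3 + j) G)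
  scaled-minimum≤h (inj₁ q<0) = ℚ.<-≤-trans q<0 (ι-mono-≤ {0} {h (3 + j) G} z≤n)
  scaled-minimum≤h {q} (inj₂ (a , b , 0≤a , 0≤b , a<c , b∈ , q≤ab)) with rounded bound b∈
  ... | b′ , b<b′ , b′∈ = begin-strict
    q                                     ≤⟨ q≤ab ⟩
    a ℚ.* b                               <⟨ *-mono-< 0≤a 0≤b a<c b<b′ ⟩
    (+ 1 / k) ℚ.* b′                      ≤⟨ ℚ.*-monoˡ-≤-nonNeg (+ 1 / k) {{ℚ.normalize-nonNeg 1 k}}
                                               (bound⇒≤-h (ℚ.≤-<-trans 0≤b b<b′) b′∈) ⟩
    (+ 1 / k) ℚ.* ι (k * h (3 + j) G)     ≡⟨ 1/-*-cancel k (h (3 + j) G) ⟩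
    ι (h (3 + j) G) ∎
    where open ℚ.≤-Reasoning

theorem1p3 : (r : ℕ) → 4 ≤ r →
    ∃ λ (c : ℝ) → 0ℝ <ℝ c ×
    (∀ {n} (G : Graph n) → let m = χ G in
    c *ℝ minimum (fromℕ m)
    (applyUpTo (λ i → let ℓ = 3 + i in root (ℓ ∸ 1) (fromℚ (+ (m ^ ℓ) / suc (C ℓ G))))
    (r ∸ 3))
    ≤ℝ fromℕ (h r G))
theorem1p3 (suc (suc (suc j@(suc _)))) _ =
  -- With r = 3 + j this constant is 1 / (4 r - 10).
  fromℚ (+ 1 / k) ,
  (0ℚ , ℚ.<-irrefl refl , ℚ.positive⁻¹ (+ 1 / k) {{ℚ.normalize-pos 1 k}}) ,
  λ G → scaled-minimum≤h G j
  where k = 2 * suc (2 * j)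
theorem1p3 1 (s≤s ())
theorem1p3 2 (s≤s (s≤s ()))
theorem1p3 3 (s≤s (s≤s (s≤s ())))
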